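{- Double helices exist for all orders $n$.
   Context: All strings are over the alphabet $\{0,1\}$. A DeBruijn string of order $n$ is a binary string of minimal length (namely $2^n+n-1$) that contains every binary string of length $n$ as a (contiguous) substring. The DeBruijn graph $\mathcal{B}^n$ is the directed graph whose vertices are the binary strings of length $n$, with an edge from $x\rho$ (with $x$ a digit, $|\rho|=n-1$) to each of $\rho0$ and $\rho1$, and no other edges. A DeBruijn string $X$ of order $n$ begins and ends with the same string of length $n-1$, so the path visiting in order its successive substrings of length $n$ closes up, by the edge from its last vertex to its first, to a Hamiltonian circuit of $\mathcal{B}^n$. $X$ is called a double helix of order $n$ if the graph obtained from $\mathcal{B}^n$ by removing the edges of this circuit has exactly 3 connected components (described as the minimum number possible), including the loop from the all-zero string of length $n$ to itself and the loop from the all-one string of length $n$ to itself.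
   Formalization: Stated for all orders n ≥ 2: for n = 1 the only circuit 0→1→0 leaves just the two loops, i.e. 2 components rather than 3, so no double helix of order 1 exists, and for n = 0 the graph is not defined. -}

module Defs where

open import Data.Bool using (Bool; true; false)
open import Data.Fin using (Fin)
open import Data.List using (List; length; take; drop)
open import Data.List.Relation.Binary.Infix.Heterogeneous using (Infix)
open import Data.Nat using (ℕ; suc; _+_; _∸_; _^_; _≤_)
open import Data.Product using (_×_)
open import Data.Vec using (Vec; _∷_; _∷ʳ_; replicate; toList)
open import Function.Bundles using (_⇔_)
open import Function.Definitions using (Surjective)
open import Level using (0ℓ)
open import Relation.Binary.Core using (Rel)
open import Relation.Binary.Construct.Closure.Equivalence using (EqClosure)
open import Relation.Binary.PropositionalEquality using (_≡_)
open import Relation.Nullary using (¬_)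

ContainsAll : ℕ → List Bool → Set
ContainsAll n X = (w : Vec Bool n) → Infix _≡_ (toList w) X

record IsDeBruijnString (n : ℕ) (X : List Bool) : Set where
  field
    containsAll : ContainsAll n X
    minimal     : ∀ Y → ContainsAll n Y → length X ≤ length Y
    hasLength   : length X ≡ 2 ^ n + n ∸ 1

data Edge : ∀ {n} → Rel (Vec Bool n) 0ℓ where
  shift : ∀ {m} (x : Bool) (ρ : Vec Bool m) (y : Bool) {v : Vec Bool (suc m)} →
          v ≡ ρ ∷ʳ y → Edge (x ∷ ρ) v

-- `take` truncates, but `toList u` has length n, so for n ≥ 1 this forces
-- i + n ≤ length X.
OccursAt : ∀ {n} → List Bool → ℕ → Vec Bool n → Set
OccursAt {n} X i u = take n (drop i X) ≡ toList u

data CircuitEdge {n : ℕ} (X : List Bool) (u v : Vec Bool n) : Set where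
  step  : ∀ i → OccursAt X i u → OccursAt X (suc i) v → CircuitEdge X u v
  close : ∀ i → i + n ≡ length X → OccursAt X i u → OccursAt X 0 v →
          CircuitEdge X u v

-- For n ≥ 1 the De Bruijn graph has no parallel edges, so an edge is
-- determined by its ordered pair of endpoints.
ResidualEdge : ∀ {n} → List Bool → Rel (Vec Bool n) 0ℓ
ResidualEdge X u v = Edge u v × ¬ CircuitEdge X u v

-- Connected components of a directed graph are those of the underlying
-- undirected graph, i.e. the classes of the generated equivalence relation.
Connected : ∀ {V : Set} → Rel V 0ℓ → Rel V 0ℓ
Connected E = EqClosure E

record HasComponents {V : Set} (E : Rel V 0ℓ) (k : ℕ) : Set where
  field
    component  : V → Fin k
    surjective : Surjective _≡_ _≡_ component
    classifies : ∀ u v → component u ≡ component v ⇔ Connected E u v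

IsLoopComponent : ∀ {V : Set} → Rel V 0ℓ → V → Set
IsLoopComponent E v = E v v × (∀ u → Connected E v u → u ≡ v)

record IsDoubleHelix (n : ℕ) (X : List Bool) : Set where
  field
    isDeBruijn      : IsDeBruijnString n X
    threeComponents : HasComponents (ResidualEdge {n} X) 3
    zeroLoop        : IsLoopComponent (ResidualEdge X) (replicate n false)
    oneLoop         : IsLoopComponent (ResidualEdge X) (replicate n true)

{-# OPTIONS --safe #-}
-- Lempel's homomorphism D (xor of neighbouring digits) maps the De Bruijn graph of
-- order n + 1 two-to-one onto the one of order n. Let s be the successor map of the
-- circuit of a double helix of order n and t that of the residual graph, whose cycles
-- are the two loops and one cycle through all other vertices. The circuit has even
-- weight, so s lifts to two complementary cycles. The long cycle of t has odd weight,
-- so it lifts to a single cycle, while the loop at 1…1 lifts to the 2-cycle of the two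
-- alternating words. The words a = 1010… and b = 0010… differ in the first digit only,
-- hence have the same out-neighbours; exchanging their successors, in both maps, joins
-- the two lifts of the circuit and joins the alternating 2-cycle to the long residual
-- cycle. This is a double helix of order n + 1.
module Submission where

open import Defs
open import Data.Bool using (Bool; true; false; not; _xor_)
import Data.Bool.Properties as Boolₚ
open import Data.Fin using (Fin; zero; suc)
open import Data.List using (List; []; _∷_; _++_; length; take; drop; applyUpTo)
open import Data.List.Membership.Propositional using (_∈_; _∉_)
open import Data.List.Membership.Propositional.Properties
  using (∈-∃++; ∈-++⁺ˡ; ∈-++⁺ʳ; ∈-applyUpTo⁺)
import Data.List.Properties as Listₚ
open import Data.List.Relation.Binary.Infix.Heterogeneous using (Infix; here; there; MkView; toView)
open import Data.List.Relation.Binary.Permutation.Propositional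
  using (_↭_; refl; prep; swap; trans; ↭-sym)
open import Data.List.Relation.Binary.Permutation.Propositional.Properties
  using (∈-resp-↭; ↭-length; ++-comm)
open import Data.List.Relation.Binary.Pointwise using (Pointwise-≡⇒≡; ≡⇒Pointwise-≡)
import Data.List.Relation.Binary.Prefix.Heterogeneous as Prefix
open import Data.List.Relation.Unary.Any using (here; there)
open import Data.Nat using (ℕ; zero; suc; _+_; _*_; _∸_; _^_; _≤_; _<_; z≤n; s≤s; s≤s⁻¹)
import Data.Nat.Properties as ℕₚ
open import Data.Product using (Σ; ∃; _×_; _,_; proj₂)
open import Data.Sum using (_⊎_; inj₁; inj₂)
import Data.Sum as Sum
open import Data.Vec using (Vec; []; _∷_; _∷ʳ_; head; replicate; toList)
import Data.Vec.Properties as Vecₚ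
open import Function using (_∘_)
open import Function.Bundles using (mk⇔)
open import Relation.Binary.Construct.Closure.Equivalence
  using (return; gfold; reflexive; transitive; symmetric)
open import Relation.Binary.Definitions using (DecidableEquality)
open import Relation.Binary.PropositionalEquality
  using (_≡_; _≢_; refl; sym; cong; cong₂; subst; isEquivalence; module ≡-Reasoning)
  renaming (trans to ≡-trans)
open import Relation.Nullary using (¬_; yes; no; contradiction)

-- Orbits of a map

iter : {V : Set} → (V → V) → ℕ → V → V
iter s zero    u = u
iter s (suc i) u = iter s i (s u)

-- The list holds every vertex visited except the last one.
data Path {V : Set} (s : V → V) : V → List V → V → Set where
  []   : ∀ {u} → Path s u [] u
  step : ∀ {u w l v} → s u ≡ w → Path s w l v → Path s u (u ∷ l) v

module _ {V : Set} {s : V → V} where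

  infixr 5 _◅◅_
  _◅◅_ : ∀ {u k v l w} → Path s u k v → Path s v l w → Path s u (k ++ l) w
  []       ◅◅ q = q
  step e p ◅◅ q = step e (p ◅◅ q)

  split : ∀ {u w} k {l} → Path s u (k ++ l) w → ∃ λ v → Path s u k v × Path s v l w
  split []      p          = _ , [] , p
  split (_ ∷ k) (step e p) with v , q , r ← split k p = v , step e q , r

  -- Cutting a closed path at `v` and swapping the two pieces gives the same cycle read from `v`.
  -- The permutation is what later carries length, parity and membership over to the new reading.
  rotate : ∀ {u l v} → Path s u l u → v ∈ l → ∃ λ k → Path s (s v) k v × (v ∷ k) ↭ l
  rotate {v = v} p v∈l with k₁ , k₂ , refl ← ∈-∃++ v∈l
    with _ , q , step refl r ← split k₁ p = k₂ ++ k₁ , r ◅◅ q , ++-comm (v ∷ k₂) k₁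

  retrace : ∀ {s′ : V → V} {u l v} → (∀ {w} → w ∈ l → s′ w ≡ s w) → Path s u l v → Path s′ u l v
  retrace eq []         = []
  retrace eq (step e p) = step (≡-trans (eq (here refl)) e) (retrace (eq ∘ there) p)

  iter-end : ∀ {u l v} → Path s u l v → iter s (length l) u ≡ v
  iter-end []            = refl
  iter-end (step refl p) = iter-end p

  iter-index : ∀ {u l v w} → Path s u l v → w ∈ l → ∃ λ i → i < length l × iter s i u ≡ w
  iter-index (step refl p) (here refl) = 0 , s≤s z≤n , refl
  iter-index (step refl p) (there w∈l) with i , i< , eq ← iter-index p w∈l = suc i , s≤s i< , eq

  path-closed : ∀ {u l v w} → Path s u l v → w ∈ l → s w ∈ l ⊎ s w ≡ v
  path-closed (step refl [])          (here refl) = inj₂ refl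
  path-closed (step refl (step _ _))  (here refl) = inj₁ (there (here refl))
  path-closed (step _ p)              (there w∈l) = Sum.map₁ there (path-closed p w∈l)

-- Exchanging two values of a map

module Exchange {V : Set} (_≟_ : DecidableEquality V) (a b : V) where

  exchange : (V → V) → V → V
  exchange s v with v ≟ a
  ... | yes _ = s b
  ... | no _ with v ≟ b
  ...   | yes _ = s a
  ...   | no _  = s v

  exchange-a : ∀ s → exchange s a ≡ s b
  exchange-a s with a ≟ a
  ... | yes _  = refl
  ... | no a≢a = contradiction refl a≢a

  exchange-b : a ≢ b → ∀ s → exchange s b ≡ s a
  exchange-b a≢b s with b ≟ a
  ... | yes refl = contradiction refl a≢b
  ... | no _ with b ≟ b
  ...   | yes _  = refl
  ...   | no b≢b = contradiction refl b≢b

  exchange-other : ∀ s {v} → v ≢ a → v ≢ b → exchange s v ≡ s v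
  exchange-other s {v} v≢a v≢b with v ≟ a
  ... | yes v≡a = contradiction v≡a v≢a
  ... | no _ with v ≟ b
  ...   | yes v≡b = contradiction v≡b v≢b
  ...   | no _    = refl

  exchange-elim : (P : V → V → Set) → ∀ {s} → P a (s b) → P b (s a) → (∀ v → P v (s v)) →
                  ∀ v → P v (exchange s v)
  exchange-elim P pa pb p v with v ≟ a
  ... | yes refl = pa
  ... | no _ with v ≟ b
  ...   | yes refl = pb
  ...   | no _     = p v

  -- At each vertex both exchanged maps take the old values at one common vertex.
  exchange-≢ : ∀ {s t} → (∀ v → s v ≢ t v) → ∀ v → exchange s v ≢ exchange t v
  exchange-≢ s≢t v with v ≟ a
  ... | yes _ = s≢t b
  ... | no _ with v ≟ b
  ...   | yes _ = s≢t a
  ...   | no _  = s≢t v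

-- Counting binary words

tailsAt : ∀ {n} → Bool → List (Vec Bool (suc n)) → List (Vec Bool n)
tailsAt x     []                = []
tailsAt false ((false ∷ ρ) ∷ l) = ρ ∷ tailsAt false l
tailsAt false ((true  ∷ ρ) ∷ l) = tailsAt false l
tailsAt true  ((false ∷ ρ) ∷ l) = tailsAt true l
tailsAt true  ((true  ∷ ρ) ∷ l) = ρ ∷ tailsAt true l

length-tailsAt : ∀ {n} (l : List (Vec Bool (suc n))) →
                 length (tailsAt false l) + length (tailsAt true l) ≡ length l
length-tailsAt []                = refl
length-tailsAt ((false ∷ ρ) ∷ l) = cong suc (length-tailsAt l)
length-tailsAt ((true  ∷ ρ) ∷ l) = ≡-trans (ℕₚ.+-suc _ _) (cong suc (length-tailsAt l))

∈-tailsAt : ∀ {n} x {ρ : Vec Bool n} {l} → (x ∷ ρ) ∈ l → ρ ∈ tailsAt x l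
∈-tailsAt false (here refl)                     = here refl
∈-tailsAt true  (here refl)                     = here refl
∈-tailsAt false {l = (false ∷ _) ∷ _} (there i) = there (∈-tailsAt false i)
∈-tailsAt false {l = (true  ∷ _) ∷ _} (there i) = ∈-tailsAt false i
∈-tailsAt true  {l = (false ∷ _) ∷ _} (there i) = ∈-tailsAt true i
∈-tailsAt true  {l = (true  ∷ _) ∷ _} (there i) = there (∈-tailsAt true i)

-- Pigeonhole by halving: the entries with a given first digit must themselves cover all words that
-- are one digit shorter.
cover-length : ∀ n {l : List (Vec Bool n)} → (∀ v → v ∈ l) → 2 ^ n ≤ length l
cover-length zero {[]} cover with () ← cover []
cover-length zero {_ ∷ _} cover = s≤s z≤n
cover-length (suc n) {l} cover = begin
  2 ^ n + (2 ^ n + 0)                               ≡⟨ cong (2 ^ n +_) (ℕₚ.+-identityʳ _) ⟩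
  2 ^ n + 2 ^ n                                     ≤⟨ ℕₚ.+-mono-≤ (half false) (half true) ⟩
  length (tailsAt false l) + length (tailsAt true l) ≡⟨ length-tailsAt l ⟩
  length l                                          ∎
  where
  open ℕₚ.≤-Reasoning
  half : ∀ x → 2 ^ n ≤ length (tailsAt x l)
  half x = cover-length n (λ ρ → ∈-tailsAt x (cover (x ∷ ρ)))

no-short-cover : ∀ n {l : List (Vec Bool n)} → suc (length l) ≡ 2 ^ n → ¬ (∀ v → v ∈ l)
no-short-cover n eq cover = ℕₚ.1+n≰n (ℕₚ.≤-trans (ℕₚ.≤-reflexive eq) (cover-length n cover))

-- Parities

odd : ℕ → Bool
odd zero    = false
odd (suc n) = not (odd n)

odd-+ : ∀ m n → odd (m + n) ≡ odd m xor odd n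
odd-+ zero    n = refl
odd-+ (suc m) n = ≡-trans (cong not (odd-+ m n)) (Boolₚ.not-distribˡ-xor (odd m) (odd n))

odd-2* : ∀ n → odd (2 * n) ≡ false
odd-2* n = begin
  odd (n + (n + 0)) ≡⟨ cong (λ k → odd (n + k)) (ℕₚ.+-identityʳ n) ⟩
  odd (n + n)       ≡⟨ odd-+ n n ⟩
  odd n xor odd n   ≡⟨ Boolₚ.xor-same (odd n) ⟩
  false             ∎
  where open ≡-Reasoning

not-true : ∀ {x} → not x ≡ false → x ≡ true
not-true {true} _ = refl

-- Along a path the first digits are the digits spelled by the walk, so this is the weight modulo 2
-- of the spelled string.
parity : ∀ {n} → List (Vec Bool (suc n)) → Bool
parity []      = false
parity (u ∷ l) = head u xor parity l

parity-++ : ∀ {n} (k l : List (Vec Bool (suc n))) → parity (k ++ l) ≡ parity k xor parity l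
parity-++ []      l = refl
parity-++ (u ∷ k) l = ≡-trans (cong (head u xor_) (parity-++ k l)) (sym (Boolₚ.xor-assoc (head u) _ _))

xor-swap : ∀ x y z → x xor (y xor z) ≡ y xor (x xor z)
xor-swap false y     z = refl
xor-swap true  false z = refl
xor-swap true  true  z = refl

parity-↭ : ∀ {n} {k l : List (Vec Bool (suc n))} → k ↭ l → parity k ≡ parity l
parity-↭ refl         = refl
parity-↭ (prep u p)   = cong (head u xor_) (parity-↭ p)
parity-↭ (swap u v p) = ≡-trans (xor-swap (head u) (head v) _)
                                (cong (λ z → head v xor (head u xor z)) (parity-↭ p))
parity-↭ (trans p q)  = ≡-trans (parity-↭ p) (parity-↭ q)

-- Lempel's homomorphism

lower : ∀ {n} → Vec Bool (suc n) → Vec Bool n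
lower (x ∷ [])    = []
lower (x ∷ y ∷ v) = (x xor y) ∷ lower (y ∷ v)

-- The digits of `u` serve as successive differences, starting from the digit `b`; the lifts for the
-- two values of `b` are complementary and form the fibre of `lower` over `u`.
lift : ∀ {n} → Bool → Vec Bool n → Vec Bool (suc n)
lift b []      = b ∷ []
lift b (x ∷ u) = b ∷ lift (b xor x) u

head-lift : ∀ {n} b (u : Vec Bool n) → head (lift b u) ≡ b
head-lift b []      = refl
head-lift b (x ∷ u) = refl

xor-cancelˡ : ∀ x y → x xor (x xor y) ≡ y
xor-cancelˡ x y = ≡-trans (sym (Boolₚ.xor-assoc x x y)) (cong (_xor y) (Boolₚ.xor-same x))

lower-∷-lift : ∀ {n} x y (u : Vec Bool n) → lower (x ∷ lift y u) ≡ (x xor y) ∷ lower (lift y u)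
lower-∷-lift x y []      = refl
lower-∷-lift x y (z ∷ u) = refl

lower-lift : ∀ {n} b (u : Vec Bool n) → lower (lift b u) ≡ u
lower-lift b []      = refl
lower-lift b (x ∷ u) = ≡-trans (lower-∷-lift b (b xor x) u)
                               (cong₂ _∷_ (xor-cancelˡ b x) (lower-lift (b xor x) u))

lift-lower : ∀ {n} (v : Vec Bool (suc n)) → lift (head v) (lower v) ≡ v
lift-lower (x ∷ [])    = refl
lift-lower (x ∷ y ∷ v) =
  cong (x ∷_) (≡-trans (cong (λ z → lift z (lower (y ∷ v))) (xor-cancelˡ x y)) (lift-lower (y ∷ v)))

lift-injective : ∀ {n} {b b′} {u u′ : Vec Bool n} → lift b u ≡ lift b′ u′ → b ≡ b′ × u ≡ u′
lift-injective {b = b} {b′} {u} {u′} eq =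
  ≡-trans (sym (head-lift b u)) (≡-trans (cong head eq) (head-lift b′ u′)) ,
  ≡-trans (sym (lower-lift b u)) (≡-trans (cong lower eq) (lower-lift b′ u′))

lift-zeros : ∀ b n → lift b (replicate n false) ≡ replicate (suc n) b
lift-zeros b zero    = refl
lift-zeros b (suc n) =
  cong (b ∷_) (≡-trans (cong (λ z → lift z _) (Boolₚ.xor-identityʳ b)) (lift-zeros b n))

lift-∷ʳ : ∀ {n} b (u : Vec Bool n) y → ∃ λ z → lift b (u ∷ʳ y) ≡ lift b u ∷ʳ z
lift-∷ʳ b []      y = b xor y , refl
lift-∷ʳ b (x ∷ u) y with z , eq ← lift-∷ʳ (b xor x) u y = z , cong (b ∷_) eq

-- An edge drops the first digit, so the lift of `v` has to start with the second digit of
-- `lift b u`, which is `b xor head u`.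
Edge-lift : ∀ {n} b {u v : Vec Bool (suc n)} → Edge u v → Edge (lift b u) (lift (b xor head u) v)
Edge-lift b (shift x ρ y refl) with z , eq ← lift-∷ʳ (b xor x) ρ y = shift b _ z eq

-- Out-neighbours do not depend on the first digit. This makes the exchange of successors
-- legitimate.
Edge-changeHead : ∀ {n x} x′ {ρ : Vec Bool n} {v} → Edge (x ∷ ρ) v → Edge (x′ ∷ ρ) v
Edge-changeHead x′ (shift _ ρ y eq) = shift x′ ρ y eq

module _ {n : ℕ} (s : Vec Bool (suc n) → Vec Bool (suc n)) where

  liftMap : Vec Bool (suc (suc n)) → Vec Bool (suc (suc n))
  liftMap v = lift (head v xor head (lower v)) (s (lower v))

  liftMap-lift : ∀ b u → liftMap (lift b u) ≡ lift (b xor head u) (s u)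
  liftMap-lift b u = cong₂ (λ x w → lift (x xor head w) (s w)) (head-lift b u) (lower-lift b u)

  liftMap-Edge : (∀ u → Edge u (s u)) → ∀ v → Edge v (liftMap v)
  liftMap-Edge e v = subst (λ w → Edge w (liftMap v)) (lift-lower v) (Edge-lift (head v) (e (lower v)))

lifts : ∀ {n} → Bool → List (Vec Bool (suc n)) → List (Vec Bool (suc (suc n)))
lifts b []      = []
lifts b (u ∷ l) = lift b u ∷ lifts (b xor head u) l

length-lifts : ∀ {n} b (l : List (Vec Bool (suc n))) → length (lifts b l) ≡ length l
length-lifts b []      = refl
length-lifts b (u ∷ l) = cong suc (length-lifts _ l)

∈-lifts⁻ : ∀ {n} b {l : List (Vec Bool (suc n))} {b′ u} → lift b′ u ∈ lifts b l → u ∈ l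
∈-lifts⁻ b {_ ∷ _} (here eq) = here (proj₂ (lift-injective eq))
∈-lifts⁻ b {_ ∷ _} (there i) = there (∈-lifts⁻ _ i)

-- The two lifts of a walk stay complementary at every position, so together they meet both
-- preimages of each vertex.
∈-lifts⁺ : ∀ {n} b b′ {l : List (Vec Bool (suc n))} {u} → u ∈ l →
           lift b′ u ∈ lifts b l ⊎ lift b′ u ∈ lifts (not b) l
∈-lifts⁺ false false (here refl) = inj₁ (here refl)
∈-lifts⁺ false true  (here refl) = inj₂ (here refl)
∈-lifts⁺ true  false (here refl) = inj₂ (here refl)
∈-lifts⁺ true  true  (here refl) = inj₁ (here refl)
∈-lifts⁺ b b′ {w ∷ l} {u} (there i) =
  Sum.map there
    (there ∘ subst (λ z → lift b′ u ∈ lifts z l) (Boolₚ.not-distribˡ-xor b (head w)))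
    (∈-lifts⁺ (b xor head w) b′ i)

-- At each position the two lifts start with opposite digits, so each position contributes exactly
-- one 1 to the joint weight.
parity-lifts : ∀ {n} b (l : List (Vec Bool (suc n))) →
               parity (lifts b l) xor parity (lifts (not b) l) ≡ odd (length l)
parity-lifts b []      = refl
parity-lifts b (u ∷ l) = begin
  (head (lift b u) xor p) xor (head (lift (not b) u) xor parity (lifts (not b xor head u) l))
    ≡⟨ cong₂ (λ x y → (x xor p) xor y) (head-lift b u)
         (cong₂ (λ x y → x xor parity (lifts y l)) (head-lift (not b) u)
           (sym (Boolₚ.not-distribˡ-xor b (head u)))) ⟩
  (b xor p) xor (not b xor q)
    ≡⟨ complement b p q ⟩
  not (p xor q)
    ≡⟨ cong not (parity-lifts (b xor head u) l) ⟩
  not (odd (length l)) ∎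
  where
  open ≡-Reasoning
  p = parity (lifts (b xor head u) l)
  q = parity (lifts (not (b xor head u)) l)
  complement : ∀ x p q → (x xor p) xor (not x xor q) ≡ not (p xor q)
  complement false false q = refl
  complement false true  q = refl
  complement true  false q = refl
  complement true  true  q = sym (Boolₚ.not-involutive q)

-- Each step adds the first digit of the vertex left behind to the leading digit of the lift. Hence
-- a closed path lifts to a closed one if its weight is even, and otherwise leads to the
-- complementary lift.
liftPath : ∀ {n} {s : Vec Bool (suc n) → Vec Bool (suc n)} b {u l v} → Path s u l v →
           Path (liftMap s) (lift b u) (lifts b l) (lift (b xor parity l) v)
liftPath {s = s} b {u} [] =
  subst (λ z → Path (liftMap s) (lift b u) [] (lift z u)) (sym (Boolₚ.xor-identityʳ b)) []
liftPath {s = s} b {u} {v = v} (step {l = l} refl p) =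
  step (liftMap-lift s b u)
    (subst (λ z → Path (liftMap s) _ (lifts (b xor head u) l) (lift z v))
      (Boolₚ.xor-assoc b (head u) (parity l)) (liftPath (b xor head u) p))

-- Complementary pairs of successor maps

zeros ones 01⋯1 10⋯0 : ∀ m → Vec Bool (2 + m)
zeros m = replicate (2 + m) false
ones  m = replicate (2 + m) true
01⋯1  m = false ∷ replicate (1 + m) true
10⋯0  m = true ∷ replicate (1 + m) false

-- The circuit visits 01⋯1 ∷ ones ∷ sl and the long residual cycle visits 01⋯1 ∷ tl.
-- The digits 0 and 1 heading 01⋯1 and ones make s-parity say that the circuit has even
-- weight, and t-parity that the residual cycle has odd weight.
record Helix (m : ℕ) : Set where
  field
    s t       : Vec Bool (2 + m) → Vec Bool (2 + m)
    s-Edge    : ∀ u → Edge u (s u)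
    t-Edge    : ∀ u → Edge u (t u)
    s≢t       : ∀ u → s u ≢ t u
    s-01⋯1    : s (01⋯1 m) ≡ ones m
    s-10⋯0    : s (10⋯0 m) ≡ zeros m
    t-zeros   : t (zeros m) ≡ zeros m
    t-ones    : t (ones m) ≡ ones m
    sl        : List (Vec Bool (2 + m))
    s-path    : Path s (s (ones m)) sl (01⋯1 m)
    s-length  : 2 + length sl ≡ 2 ^ (2 + m)
    s-cover   : ∀ v → v ∈ 01⋯1 m ∷ ones m ∷ sl
    s-parity  : parity sl ≡ true
    tl        : List (Vec Bool (2 + m))
    t-path    : Path t (t (01⋯1 m)) tl (01⋯1 m)
    t-length  : 3 + length tl ≡ 2 ^ (2 + m)
    t-cover   : ∀ v → v ∈ zeros m ∷ ones m ∷ 01⋯1 m ∷ tl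
    t-parity  : parity tl ≡ true

-- The base case of order 2

helix₂ : Helix 0
helix₂ = record
  { s = s ; t = t ; s-Edge = s-Edge ; t-Edge = t-Edge ; s≢t = s≢t
  ; s-01⋯1 = refl ; s-10⋯0 = refl ; t-zeros = refl ; t-ones = refl
  ; sl = (true ∷ false ∷ []) ∷ (false ∷ false ∷ []) ∷ []
  ; s-path = step refl (step refl [])
  ; s-length = refl
  ; s-cover = λ
    { (false ∷ false ∷ []) → there (there (there (here refl)))
    ; (false ∷ true  ∷ []) → here refl
    ; (true  ∷ false ∷ []) → there (there (here refl))
    ; (true  ∷ true  ∷ []) → there (here refl) }
  ; s-parity = refl
  ; tl = (true ∷ false ∷ []) ∷ []
  ; t-path = step refl []
  ; t-length = refl
  ; t-cover = λ
    { (false ∷ false ∷ []) → here refl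
    ; (false ∷ true  ∷ []) → there (there (here refl))
    ; (true  ∷ false ∷ []) → there (there (there (here refl)))
    ; (true  ∷ true  ∷ []) → there (here refl) }
  ; t-parity = refl
  }
  where
  -- `s` is the complemented cycling register, with the cycle 01, 11, 10, 00. `t` is the pure
  -- cycling register, with two loops and the cycle 01, 10.
  s t : Vec Bool 2 → Vec Bool 2
  s (x ∷ y ∷ []) = y ∷ not x ∷ []
  t (x ∷ y ∷ []) = y ∷ x ∷ []
  s-Edge : ∀ u → Edge u (s u)
  s-Edge (x ∷ y ∷ []) = shift x (y ∷ []) (not x) refl
  t-Edge : ∀ u → Edge u (t u)
  t-Edge (x ∷ y ∷ []) = shift x (y ∷ []) x refl
  s≢t : ∀ u → s u ≢ t u
  s≢t (false ∷ y ∷ []) ()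
  s≢t (true  ∷ y ∷ []) ()

module HelixProperties {m : ℕ} (H : Helix m) where
  open Helix H

  -- The circuit lists all words with exactly as many entries as there are words. A repeated entry
  -- could be deleted, leaving a cover that is too short; the four lemmas that follow use the same
  -- argument.
  ones∉sl : ones m ∉ sl
  ones∉sl i = no-short-cover (2 + m) {01⋯1 m ∷ sl} s-length λ v → case (s-cover v)
    where
    case : ∀ {v} → v ∈ 01⋯1 m ∷ ones m ∷ sl → v ∈ 01⋯1 m ∷ sl
    case (here e)              = here e
    case (there (here refl))   = there i
    case (there (there j))     = there j

  01⋯1∉sl : 01⋯1 m ∉ sl
  01⋯1∉sl i = no-short-cover (2 + m) {ones m ∷ sl} s-length λ v → case (s-cover v)
    where
    case : ∀ {v} → v ∈ 01⋯1 m ∷ ones m ∷ sl → v ∈ ones m ∷ sl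
    case (here refl) = there i
    case (there j)   = j

  zeros∉tl : zeros m ∉ tl
  zeros∉tl i = no-short-cover (2 + m) {ones m ∷ 01⋯1 m ∷ tl} t-length λ v → case (t-cover v)
    where
    case : ∀ {v} → v ∈ zeros m ∷ ones m ∷ 01⋯1 m ∷ tl → v ∈ ones m ∷ 01⋯1 m ∷ tl
    case (here refl) = there (there i)
    case (there j)   = j

  ones∉tl : ones m ∉ tl
  ones∉tl i = no-short-cover (2 + m) {zeros m ∷ 01⋯1 m ∷ tl} t-length λ v → case (t-cover v)
    where
    case : ∀ {v} → v ∈ zeros m ∷ ones m ∷ 01⋯1 m ∷ tl → v ∈ zeros m ∷ 01⋯1 m ∷ tl
    case (here e)            = here e
    case (there (here refl)) = there (there i)
    case (there (there j))   = there j

  01⋯1∉tl : 01⋯1 m ∉ tl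
  01⋯1∉tl i = no-short-cover (2 + m) {zeros m ∷ ones m ∷ tl} t-length λ v → case (t-cover v)
    where
    case : ∀ {v} → v ∈ zeros m ∷ ones m ∷ 01⋯1 m ∷ tl → v ∈ zeros m ∷ ones m ∷ tl
    case (here e)                    = here e
    case (there (here e))            = there (here e)
    case (there (there (here refl))) = there (there i)
    case (there (there (there j)))   = there (there j)

-- The induction step: lifting both maps and exchanging two successors

module HelixStep {m : ℕ} (H : Helix m) where
  open Helix H
  open HelixProperties H

  -- A bar denotes the complement. `a` and `ā` are the alternating words, which lie over `ones m`,
  -- while `b` and `b̄` lie over `01⋯1 m`.
  a ā b b̄ : Vec Bool (3 + m)
  a = lift true  (ones m)
  ā = lift false (ones m)
  b = lift false (01⋯1 m)
  b̄ = lift true  (01⋯1 m)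

  open Exchange (Vecₚ.≡-dec Boolₚ._≟_) a b

  S T s′ t′ : Vec Bool (3 + m) → Vec Bool (3 + m)
  S  = liftMap s
  T  = liftMap t
  s′ = exchange S
  t′ = exchange T

  a≢b : a ≢ b
  a≢b ()

  S-b : S b ≡ ā
  S-b = ≡-trans (liftMap-lift s false (01⋯1 m)) (cong (lift false) s-01⋯1)

  exchange-lift : ∀ r x u → lift x u ≢ a → lift x u ≢ b →
                  exchange (liftMap r) (lift x u) ≡ lift (x xor head u) (r u)
  exchange-lift r x u ≢a ≢b =
    ≡-trans (exchange-other (liftMap r) {lift x u} ≢a ≢b) (liftMap-lift r x u)

  s′-ā : s′ ā ≡ lift true (s (ones m))
  s′-ā = exchange-lift s false (ones m) (λ ()) (λ ())

  s′-b : s′ b ≡ lift false (s (ones m))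
  s′-b = ≡-trans (exchange-b a≢b S) (liftMap-lift s true (ones m))

  s′-b̄ : s′ b̄ ≡ a
  s′-b̄ = ≡-trans (exchange-lift s true (01⋯1 m) (λ ()) (λ ())) (cong (lift true) s-01⋯1)

  s′-a : s′ a ≡ ā
  s′-a = ≡-trans (exchange-a S) S-b

  t′-b : t′ b ≡ ā
  t′-b = ≡-trans (exchange-b a≢b T)
           (≡-trans (liftMap-lift t true (ones m)) (cong (lift false) t-ones))

  t′-ā : t′ ā ≡ a
  t′-ā = ≡-trans (exchange-lift t false (ones m) (λ ()) (λ ())) (cong (lift true) t-ones)

  t′-a : t′ a ≡ lift false (t (01⋯1 m))
  t′-a = ≡-trans (exchange-a T) (liftMap-lift t false (01⋯1 m))

  t′-b̄ : t′ b̄ ≡ lift true (t (01⋯1 m))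
  t′-b̄ = exchange-lift t true (01⋯1 m) (λ ()) (λ ())

  -- As `l` avoids `ones m` and `01⋯1 m`, its lifts avoid `a` and `b`, where alone the exchange
  -- changes the map. The odd parity makes the lift end at the complementary preimage.
  exchangePath : ∀ {r : Vec Bool (2 + m) → Vec Bool (2 + m)} {u l} →
                 ones m ∉ l → 01⋯1 m ∉ l → parity l ≡ true → Path r u l (01⋯1 m) →
                 ∀ x → Path (exchange (liftMap r)) (lift x u) (lifts x l) (lift (not x) (01⋯1 m))
  exchangePath {r} {u} {l} ones∉l 01⋯1∉l odd-l p x = retrace
    (λ i → exchange-other (liftMap r)
             (λ { refl → ones∉l (∈-lifts⁻ x {b′ = true} i) })
             (λ { refl → 01⋯1∉l (∈-lifts⁻ x {b′ = false} i) }))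
    (subst (λ z → Path (liftMap r) (lift x u) (lifts x l) (lift z (01⋯1 m)))
      (≡-trans (cong (x xor_) odd-l) (Boolₚ.xor-comm x true)) (liftPath x p))

  s-paths : ∀ x → Path s′ (lift x (s (ones m))) (lifts x sl) (lift (not x) (01⋯1 m))
  s-paths = exchangePath ones∉sl 01⋯1∉sl s-parity s-path

  t-paths : ∀ x → Path t′ (lift x (t (01⋯1 m))) (lifts x tl) (lift (not x) (01⋯1 m))
  t-paths = exchangePath ones∉tl 01⋯1∉tl t-parity t-path

  sL tL : List (Vec Bool (3 + m))
  -- Under `S` the two cycles are `ā`, `lifts true sl`, `b` and `a`, `lifts false sl`, `b̄`. The
  -- exchange redirects `b` into the second cycle and `a` back to `ā`.
  sL = ā ∷ (lifts true sl ++ b ∷ (lifts false sl ++ b̄ ∷ a ∷ []))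
  -- Under `T` the long cycle is `b`, `lifts false tl`, `b̄`, `lifts true tl`. The exchange inserts
  -- the 2-cycle of `ā` and `a` directly after `b`.
  tL = b ∷ ā ∷ a ∷ (lifts false tl ++ b̄ ∷ lifts true tl)

  sL-path : Path s′ ā sL ā
  sL-path = step s′-ā (s-paths true ◅◅ step s′-b (s-paths false ◅◅ step s′-b̄ (step s′-a [])))

  tL-path : Path t′ b tL b
  tL-path = step t′-b (step t′-ā (step t′-a (t-paths false ◅◅ step t′-b̄ (t-paths true))))

  2^ : ∀ {k} → k ≡ 2 ^ (2 + m) → k + k ≡ 2 ^ (3 + m)
  2^ {k} refl = cong (k +_) (sym (ℕₚ.+-identityʳ k))

  sL-length : length sL ≡ 2 ^ (3 + m)
  sL-length = ≡-trans (cong suc eq) (2^ s-length)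
    where
    open ≡-Reasoning
    n = length sl
    eq : length (lifts true sl ++ b ∷ (lifts false sl ++ b̄ ∷ a ∷ [])) ≡ suc (n + suc (suc n))
    eq = begin
      length (lifts true sl ++ b ∷ (lifts false sl ++ b̄ ∷ a ∷ []))
        ≡⟨ Listₚ.length-++ (lifts true sl) ⟩
      length (lifts true sl) + suc (length (lifts false sl ++ b̄ ∷ a ∷ []))
        ≡⟨ cong (λ k → length (lifts true sl) + suc k) (Listₚ.length-++ (lifts false sl)) ⟩
      length (lifts true sl) + suc (length (lifts false sl) + 2)
        ≡⟨ cong₂ (λ j k → j + suc (k + 2)) (length-lifts true sl) (length-lifts false sl) ⟩
      n + suc (n + 2)
        ≡⟨ cong (λ k → n + suc k) (ℕₚ.+-comm n 2) ⟩
      n + suc (suc (suc n))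
        ≡⟨ ℕₚ.+-suc n (suc (suc n)) ⟩
      suc (n + suc (suc n)) ∎

  tL-length : 2 + length tL ≡ 2 ^ (3 + m)
  -- The 5 stands for the two loops and the leading entries `b`, `ā`, `a`.
  tL-length = ≡-trans (cong (5 +_) eq) (≡-trans (cong (3 +_) rearrange) (2^ t-length))
    where
    n = length tl
    eq : length (lifts false tl ++ b̄ ∷ lifts true tl) ≡ n + suc n
    eq = ≡-trans (Listₚ.length-++ (lifts false tl))
           (cong₂ (λ j k → j + suc k) (length-lifts false tl) (length-lifts true tl))
    rearrange : 2 + (n + suc n) ≡ n + (3 + n)
    rearrange = sym (≡-trans (ℕₚ.+-suc n (2 + n)) (cong suc (ℕₚ.+-suc n (suc n))))

  -- The first digits of `ā`, `b`, `b̄`, `a` cancel. The two lifts of `sl` leave the parity of its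
  -- length, which is two less than a power of two.
  sL-parity : parity sL ≡ false
  sL-parity = begin
    parity (lifts true sl ++ b ∷ (lifts false sl ++ b̄ ∷ a ∷ []))
      ≡⟨ parity-++ (lifts true sl) _ ⟩
    parity (lifts true sl) xor parity (lifts false sl ++ b̄ ∷ a ∷ [])
      ≡⟨ cong (parity (lifts true sl) xor_)
           (≡-trans (parity-++ (lifts false sl) _) (Boolₚ.xor-identityʳ _)) ⟩
    parity (lifts true sl) xor parity (lifts false sl)
      ≡⟨ parity-lifts true sl ⟩
    odd (length sl)
      ≡⟨ Boolₚ.not-involutive _ ⟨
    odd (2 + length sl)
      ≡⟨ cong odd s-length ⟩
    odd (2 ^ (2 + m))
      ≡⟨ odd-2* (2 ^ (1 + m)) ⟩
    false ∎
    where open ≡-Reasoning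

  -- The first digits of `b`, `ā`, `a`, `b̄` cancel again, and the length of `tl` is three less than
  -- a power of two, hence odd.
  tL-parity : parity tL ≡ true
  tL-parity = begin
    true xor parity (lifts false tl ++ b̄ ∷ lifts true tl)
      ≡⟨ cong not (parity-++ (lifts false tl) _) ⟩
    not (parity (lifts false tl) xor not (parity (lifts true tl)))
      ≡⟨ cong not (≡-trans (Boolₚ.xor-comm (parity (lifts false tl)) _)
                   (≡-trans (sym (Boolₚ.not-distribˡ-xor (parity (lifts true tl)) _))
                            (cong not (parity-lifts true tl)))) ⟩
    not (not (odd (length tl)))
      ≡⟨ Boolₚ.not-involutive _ ⟩
    odd (length tl)
      ≡⟨ not-true (≡-trans (sym (Boolₚ.not-involutive _))
                           (≡-trans (cong odd t-length) (odd-2* (2 ^ (1 + m))))) ⟩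
    true ∎
    where open ≡-Reasoning

  sL-cover : ∀ v → v ∈ sL
  sL-cover v = subst (_∈ sL) (lift-lower v) (case (head v) (s-cover (lower v)))
    where
    from-b : ∀ {w} → w ∈ b ∷ (lifts false sl ++ b̄ ∷ a ∷ []) → w ∈ sL
    from-b i = there (∈-++⁺ʳ (lifts true sl) i)
    case : ∀ x {u} → u ∈ 01⋯1 m ∷ ones m ∷ sl → lift x u ∈ sL
    case false (here refl)         = from-b (here refl)
    case true  (here refl)         = from-b (there (∈-++⁺ʳ (lifts false sl) (here refl)))
    case false (there (here refl)) = here refl
    case true  (there (here refl)) = from-b (there (∈-++⁺ʳ (lifts false sl) (there (here refl))))
    case x     (there (there i)) with ∈-lifts⁺ true x i
    ... | inj₁ j = there (∈-++⁺ˡ j)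
    ... | inj₂ j = from-b (there (∈-++⁺ˡ j))

  tL-cover : ∀ v → v ∈ zeros (suc m) ∷ ones (suc m) ∷ tL
  tL-cover v = subst (_∈ _) (lift-lower v) (case (head v) (t-cover (lower v)))
    where
    case : ∀ x {u} → u ∈ zeros m ∷ ones m ∷ 01⋯1 m ∷ tl → lift x u ∈ zeros (suc m) ∷ ones (suc m) ∷ tL
    case false (here refl) = here (lift-zeros false (2 + m))
    case true  (here refl) = there (here (lift-zeros true (2 + m)))
    case false (there (here refl)) = there (there (there (here refl)))
    case true  (there (here refl)) = there (there (there (there (here refl))))
    case false (there (there (here refl))) = there (there (here refl))
    case true  (there (there (here refl))) =
      there (there (there (there (there (∈-++⁺ʳ (lifts false tl) (here refl))))))
    case x (there (there (there i))) with ∈-lifts⁺ false x i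
    ... | inj₁ j = there (there (there (there (there (∈-++⁺ˡ j)))))
    ... | inj₂ j = there (there (there (there (there (∈-++⁺ʳ (lifts false tl) (there j))))))

  -- The edges that `s′` must contain at `01⋯1` and at `10⋯0` are the two lifts of the single edge
  -- from `10⋯0 m` to `zeros m`; this is why `Helix` records `s-10⋯0`.
  01⋯1-lift : lift false (10⋯0 m) ≡ 01⋯1 (suc m)
  01⋯1-lift = cong (false ∷_) (lift-zeros true (1 + m))

  10⋯0-lift : lift true (10⋯0 m) ≡ 10⋯0 (suc m)
  10⋯0-lift = cong (true ∷_) (lift-zeros false (1 + m))

  exchange-lift-zeros : ∀ r x u → lift x u ≢ a → lift x u ≢ b → r u ≡ zeros m →
                        exchange (liftMap r) (lift x u) ≡ replicate (3 + m) (x xor head u)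
  exchange-lift-zeros r x u ≢a ≢b ru =
    ≡-trans (exchange-lift r x u ≢a ≢b) (≡-trans (cong (lift _) ru) (lift-zeros _ (2 + m)))

  s′-01⋯1 : s′ (01⋯1 (suc m)) ≡ ones (suc m)
  s′-01⋯1 = ≡-trans (cong s′ (sym 01⋯1-lift))
    (exchange-lift-zeros s false (10⋯0 m) (λ ()) (λ ()) s-10⋯0)

  s′-10⋯0 : s′ (10⋯0 (suc m)) ≡ zeros (suc m)
  s′-10⋯0 = ≡-trans (cong s′ (sym 10⋯0-lift))
    (exchange-lift-zeros s true (10⋯0 m) 10⋯0≢ones (λ ()) s-10⋯0)
    where
    10⋯0≢ones : lift true (10⋯0 m) ≢ a
    10⋯0≢ones eq with () ← proj₂ (lift-injective {u = 10⋯0 m} {u′ = ones m} eq)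

  -- Both new loops are lifts of the old loop at `zeros m`, and the exchange does not touch them.
  t′-zeros : t′ (zeros (suc m)) ≡ zeros (suc m)
  t′-zeros = ≡-trans (cong t′ (sym (lift-zeros false (2 + m))))
    (exchange-lift-zeros t false (zeros m) (λ ()) zeros≢01⋯1 t-zeros)
    where
    zeros≢01⋯1 : lift false (zeros m) ≢ b
    zeros≢01⋯1 eq with () ← proj₂ (lift-injective {u = zeros m} {u′ = 01⋯1 m} eq)

  t′-ones : t′ (ones (suc m)) ≡ ones (suc m)
  t′-ones = ≡-trans (cong t′ (sym (lift-zeros true (2 + m))))
    (exchange-lift-zeros t true (zeros m) (λ ()) (λ ()) t-zeros)

  liftMap-≢ : ∀ v → S v ≢ T v
  liftMap-≢ v eq = s≢t (lower v) (proj₂ (lift-injective eq))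

  exchange-Edge : ∀ {r} → (∀ v → Edge v (r v)) → ∀ v → Edge v (exchange r v)
  exchange-Edge e = exchange-elim Edge (Edge-changeHead true (e b)) (Edge-changeHead false (e a)) e

  module _ {k} (p : Path s′ (s′ (01⋯1 (suc m))) k (01⋯1 (suc m))) (kσ : (01⋯1 (suc m) ∷ k) ↭ sL)
           {l} (q : Path t′ (t′ (01⋯1 (suc m))) l (01⋯1 (suc m))) (lσ : (01⋯1 (suc m) ∷ l) ↭ tL) where

    s′-Path : ∃ λ k′ → k ≡ ones (suc m) ∷ k′ × Path s′ (s′ (ones (suc m))) k′ (01⋯1 (suc m))
    -- The path starts at `ones (suc m)` and ends elsewhere, so it cannot be empty.
    s′-Path with subst (λ u → Path s′ u k (01⋯1 (suc m))) s′-01⋯1 p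
    ... | step refl p′ = _ , refl , p′

    helix-suc : Helix (suc m)
    helix-suc with k′ , refl , p′ ← s′-Path = record
      { s = s′ ; t = t′
      ; s-Edge = exchange-Edge (liftMap-Edge s s-Edge)
      ; t-Edge = exchange-Edge (liftMap-Edge t t-Edge)
      ; s≢t = exchange-≢ liftMap-≢
      ; s-01⋯1 = s′-01⋯1 ; s-10⋯0 = s′-10⋯0 ; t-zeros = t′-zeros ; t-ones = t′-ones
      ; sl = k′ ; s-path = p′
      ; s-length = ≡-trans (↭-length kσ) sL-length
      ; s-cover = λ v → ∈-resp-↭ (↭-sym kσ) (sL-cover v)
      ; s-parity = not-true (≡-trans (parity-↭ kσ) sL-parity)
      ; tl = l ; t-path = q
      ; t-length = ≡-trans (cong (2 +_) (↭-length lσ)) tL-length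
      ; t-cover = λ v → ∈-resp-↭ (prep _ (prep _ (↭-sym lσ))) (tL-cover v)
      ; t-parity = ≡-trans (parity-↭ lσ) tL-parity
      }

helix : ∀ m → Helix m
helix zero    = helix₂
helix (suc m) = let _ , p , kσ = rotate sL-path (sL-cover _)
                    _ , q , lσ = rotate tL-path 01⋯1∈tL
                in helix-suc p kσ q lσ
  where
  open HelixStep (helix m)
  01⋯1∈tL : 01⋯1 (suc m) ∈ tL
  01⋯1∈tL with there (there i) ← tL-cover (01⋯1 (suc m)) = i

-- Strings spelled by a walk

toList-inj : ∀ {n} (u v : Vec Bool n) → toList u ≡ toList v → u ≡ v
toList-inj u v eq = ≡-trans (sym (Vecₚ.cast-is-id refl u)) (Vecₚ.toList-injective refl u v eq)

take-toList : ∀ {n} (u : Vec Bool n) → take n (toList u) ≡ toList u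
take-toList []      = refl
take-toList (x ∷ u) = cong (x ∷_) (take-toList u)

take-∷ʳ : ∀ {n k} (u : Vec Bool n) y → k ≤ n → take k (toList (u ∷ʳ y)) ≡ take k (toList u)
take-∷ʳ u       y z≤n       = refl
take-∷ʳ (x ∷ u) y (s≤s k≤n) = cong (x ∷_) (take-∷ʳ u y k≤n)

take-Infix : ∀ {n} i X (u : Vec Bool n) → take n (drop i X) ≡ toList u → Infix _≡_ (toList u) X
take-Infix {n} zero X u eq = here (subst (Prefix.Prefix _≡_ (toList u)) (Listₚ.take++drop≡id n X)
  (Prefix.fromView (≡⇒Pointwise-≡ (sym eq) Prefix.++ drop n X)))
take-Infix {zero}  (suc i) []      [] eq = here Prefix.[]
take-Infix {suc n} (suc i) []      (y ∷ u) ()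
take-Infix         (suc i) (x ∷ X) u  eq = there (take-Infix i X u eq)

-- Padding a short list with `false` makes windows total, so that they can be tabulated by position.
window : ∀ n → List Bool → Vec Bool n
window zero    X       = []
window (suc n) []      = false ∷ window n []
window (suc n) (x ∷ X) = x ∷ window n X

window-++ : ∀ {n} (w : Vec Bool n) X → window n (toList w ++ X) ≡ w
window-++ []      X = refl
window-++ (x ∷ w) X = cong (x ∷_) (window-++ w X)

drop-length-++ : ∀ (k : List Bool) {l} → drop (length k) (k ++ l) ≡ l
drop-length-++ []      = refl
drop-length-++ (_ ∷ k) = drop-length-++ k

-- A string has `length Y ∸ n` positions where a window of length `suc n` fits, and the windows read
-- there cover all words.
containsAll-length : ∀ n {Y} → ContainsAll (suc n) Y → 2 ^ suc n ≤ length Y ∸ n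
containsAll-length n {Y} all = subst (2 ^ suc n ≤_) (Listₚ.length-applyUpTo _ (length Y ∸ n))
  (cover-length (suc n) cover)
  where
  windowAt : List Bool → ℕ → Vec Bool (suc n)
  windowAt Z i = window (suc n) (drop i Z)
  cover : ∀ w → w ∈ applyUpTo (windowAt Y) (length Y ∸ n)
  cover w with toView (all w)
  ... | MkView pre eqs suf with refl ← Pointwise-≡⇒≡ eqs =
    subst (_∈ applyUpTo (windowAt Z) (length Z ∸ n))
      (≡-trans (cong (window (suc n)) (drop-length-++ pre)) (window-++ w suf))
      (∈-applyUpTo⁺ (windowAt Z) inside)
    where
    Z = pre ++ toList w ++ suf
    l : length Z ≡ length pre + (suc n + length suf)
    l = ≡-trans (Listₚ.length-++ pre) (cong (length pre +_)
          (≡-trans (Listₚ.length-++ (toList w)) (cong (_+ length suf) (Vecₚ.length-toList w))))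
    inside : length pre < length Z ∸ n
    inside = ℕₚ.m+n≤o⇒m≤o∸n (suc (length pre)) (begin
      suc (length pre) + n                    ≡⟨ ℕₚ.+-suc (length pre) n ⟨
      length pre + suc n                      ≤⟨ ℕₚ.+-monoʳ-≤ (length pre) (ℕₚ.m≤m+n (suc n) (length suf)) ⟩
      length pre + (suc n + length suf)       ≡⟨ l ⟨
      length Z                                ∎)
      where open ℕₚ.≤-Reasoning

module _ {n : ℕ} (s : Vec Bool (suc n) → Vec Bool (suc n)) where

  spell : ℕ → Vec Bool (suc n) → List Bool
  spell zero    u = []
  spell (suc k) u = head u ∷ spell k (s u)

  length-spell : ∀ k u → length (spell k u) ≡ k
  length-spell zero    u = refl
  length-spell (suc k) u = cong suc (length-spell k (s u))

  drop-spell : ∀ i k u → drop i (spell (i + k) u) ≡ spell k (iter s i u)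
  drop-spell zero    k u = refl
  drop-spell (suc i) k u = drop-spell i k (s u)

  take-spell : ∀ j k u → take j (spell (j + k) u) ≡ spell j u
  take-spell zero    k u = refl
  take-spell (suc j) k u = cong (head u ∷_) (take-spell j k (s u))

  module _ (s-Edge : ∀ u → Edge u (s u)) where

    -- Every edge shifts by one digit, so the walk first spells the digits of `u` itself; a digit
    -- appended on the way is not yet reached by `take`.
    spell-short : ∀ k u → k ≤ suc n → spell k u ≡ take k (toList u)
    spell-short zero    u       _         = refl
    spell-short (suc k) (x ∷ ρ) (s≤s k≤n)
      with s (x ∷ ρ) | s-Edge (x ∷ ρ) | spell-short k (s (x ∷ ρ)) (ℕₚ.m≤n⇒m≤1+n k≤n)
    ... | _ | shift _ _ y refl | eq = cong (x ∷_) (≡-trans eq (take-∷ʳ ρ y k≤n))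

    spell-word : ∀ k u → take (suc n) (spell (suc n + k) u) ≡ toList u
    spell-word k u = ≡-trans (take-spell (suc n) k u)
      (≡-trans (spell-short (suc n) u ℕₚ.≤-refl) (take-toList u))

    spell-occurs : ∀ {K} i u → i ≤ K → OccursAt (spell (K + suc n) u) i (iter s i u)
    spell-occurs {K} i u i≤K with k , refl ← ℕₚ.m≤n⇒∃[o]m+o≡n i≤K = begin
      take (suc n) (drop i (spell (i + k + suc n) u))
        ≡⟨ cong (λ j → take (suc n) (drop i (spell j u)))
             (≡-trans (ℕₚ.+-assoc i k (suc n)) (cong (i +_) (ℕₚ.+-comm k (suc n)))) ⟩
      take (suc n) (drop i (spell (i + (suc n + k)) u))
        ≡⟨ cong (take (suc n)) (drop-spell i (suc n + k) u) ⟩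
      take (suc n) (spell (suc n + k) (iter s i u))
        ≡⟨ spell-word k (iter s i u) ⟩
      toList (iter s i u) ∎
      where open ≡-Reasoning

    -- After position `K` at most `n` digits remain, and the truncated `take` is then too short to
    -- be a word of length `suc n`.
    occurs-bound : ∀ {K} i u {v : Vec Bool (suc n)} → OccursAt (spell (K + suc n) u) i v → i ≤ K
    occurs-bound {K} i u {v} occ = ℕₚ.≮⇒≥ λ K<i → ℕₚ.1+n≰n (begin
      suc n                       ≡⟨ Vecₚ.length-toList v ⟨
      length (toList v)           ≡⟨ cong length occ ⟨
      length (take (suc n) (drop i X)) ≡⟨ Listₚ.length-take (suc n) (drop i X) ⟩
      _                           ≤⟨ ℕₚ.m⊓n≤n (suc n) _ ⟩
      length (drop i X)           ≡⟨ Listₚ.length-drop i X ⟩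
      length X ∸ i                ≡⟨ cong (_∸ i) (length-spell (K + suc n) u) ⟩
      K + suc n ∸ i               ≤⟨ ℕₚ.∸-monoʳ-≤ (K + suc n) K<i ⟩
      K + suc n ∸ suc K           ≡⟨ cong (_∸ suc K) (ℕₚ.+-suc K n) ⟩
      suc K + n ∸ suc K           ≡⟨ ℕₚ.m+n∸m≡n (suc K) n ⟩
      n                           ∎)
      where
      open ℕₚ.≤-Reasoning
      X = spell (K + suc n) u

    occurs-iter : ∀ {K} i u {v : Vec Bool (suc n)} → OccursAt (spell (K + suc n) u) i v → v ≡ iter s i u
    occurs-iter i u {v} occ = toList-inj v _ (≡-trans (sym occ) (spell-occurs i u (occurs-bound i u occ)))

iter-suc : ∀ {V : Set} (s : V → V) i u → iter s (suc i) u ≡ s (iter s i u)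
iter-suc s zero    u = refl
iter-suc s (suc i) u = iter-suc s i (s u)

-- A vertex has one successor for each appended digit, so two distinct ones exhaust them. Hence
-- removing the edges of `s` leaves exactly those of `t`.
Edge-successors : ∀ {n} {u v w w′ : Vec Bool n} → Edge u v → Edge u w → Edge u w′ → w ≢ w′ →
                  v ≡ w ⊎ v ≡ w′
Edge-successors (shift _ ρ false refl) (shift _ _ false refl) _                       _    = inj₁ refl
Edge-successors (shift _ ρ true  refl) (shift _ _ true  refl) _                       _    = inj₁ refl
Edge-successors (shift _ ρ false refl) _                      (shift _ _ false refl)  _    = inj₂ refl
Edge-successors (shift _ ρ true  refl) _                      (shift _ _ true  refl)  _    = inj₂ refl
Edge-successors (shift _ ρ false refl) (shift _ _ true  refl) (shift _ _ true  refl)  w≢w′ = contradiction refl w≢w′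
Edge-successors (shift _ ρ true  refl) (shift _ _ false refl) (shift _ _ false refl)  w≢w′ = contradiction refl w≢w′

-- From the pair of maps to a double helix

module DoubleHelix {m : ℕ} (H : Helix m) where
  open Helix H
  open HelixProperties H

  n K : ℕ
  n = 2 + m
  -- This is the last position of a window: by `s-length`, `suc K` is the number of vertices.
  K = suc (length sl)

  X : List Bool
  X = spell s (K + n) (01⋯1 m)

  circuit : Path s (01⋯1 m) (01⋯1 m ∷ ones m ∷ sl) (01⋯1 m)
  circuit = step s-01⋯1 (step refl s-path)

  position : ∀ u → ∃ λ i → i ≤ K × iter s i (01⋯1 m) ≡ u
  position u with i , i< , eq ← iter-index circuit (s-cover u) = i , s≤s⁻¹ i< , eq

  X-occurs : ∀ i → i ≤ K → OccursAt X i (iter s i (01⋯1 m))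
  X-occurs i = spell-occurs s s-Edge i (01⋯1 m)

  X-iter : ∀ i {v : Vec Bool n} → OccursAt X i v → v ≡ iter s i (01⋯1 m)
  X-iter i = occurs-iter s s-Edge {K} i (01⋯1 m)

  length-X : length X ≡ K + n
  length-X = length-spell s (K + n) (01⋯1 m)

  s-CircuitEdge : ∀ u → CircuitEdge X u (s u)
  s-CircuitEdge u with i , i≤K , refl ← position u with ℕₚ.m≤n⇒m<n∨m≡n i≤K
  ... | inj₁ i<K = step i (X-occurs i i≤K)
    (≡-trans (X-occurs (suc i) i<K) (cong toList (iter-suc s i (01⋯1 m))))
  -- At the last position the next vertex is the start again, because `suc K` steps complete the
  -- circuit.
  ... | inj₂ refl = close K (sym length-X) (X-occurs K ℕₚ.≤-refl)
    (≡-trans (X-occurs 0 z≤n) (cong toList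
      (≡-trans (sym (iter-end circuit)) (iter-suc s K (01⋯1 m)))))

  CircuitEdge-s : ∀ {u v} → CircuitEdge X u v → v ≡ s u
  CircuitEdge-s (step i p q) with refl ← X-iter i p with refl ← X-iter (suc i) q =
    iter-suc s i (01⋯1 m)
  CircuitEdge-s (close i eq p q) with refl ← X-iter i p with refl ← X-iter 0 q
    with refl ← ℕₚ.+-cancelʳ-≡ n i K (≡-trans eq length-X) =
    ≡-trans (sym (iter-end circuit)) (iter-suc s K (01⋯1 m))

  t-ResidualEdge : ∀ u → ResidualEdge X u (t u)
  t-ResidualEdge u = t-Edge u , λ c → s≢t u (sym (CircuitEdge-s c))

  ResidualEdge-t : ∀ {u v} → ResidualEdge X u v → v ≡ t u
  ResidualEdge-t {u} (e , ¬c) with Edge-successors e (s-Edge u) (t-Edge u) (s≢t u)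
  ... | inj₁ refl = contradiction (s-CircuitEdge u) ¬c
  ... | inj₂ eq   = eq

  isDeBruijn : IsDeBruijnString n X
  isDeBruijn = record
    { containsAll = λ w → let i , i≤K , eq = position w in
        take-Infix i X w (≡-trans (X-occurs i i≤K) (cong toList eq))
    ; minimal = minimal
    ; hasLength = ≡-trans length-X (cong (λ k → k + n ∸ 1) s-length)
    }
    where
    minimal : ∀ Y → ContainsAll n Y → length X ≤ length Y
    minimal Y all = begin
      length X         ≡⟨ length-X ⟩
      K + n            ≡⟨ ℕₚ.+-suc K (suc m) ⟩
      -- Truncated subtraction can be undone only if `suc m` does not exceed `length Y`, which holds
      -- because `bound` makes the difference positive.
      suc K + suc m    ≤⟨ ℕₚ.m≤o∸n⇒m+n≤o (suc K) (ℕₚ.<⇒≤ (ℕₚ.m∸n≢0⇒n<m nonzero)) bound ⟩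
      length Y         ∎
      where
      open ℕₚ.≤-Reasoning
      bound : suc K ≤ length Y ∸ suc m
      bound = subst (_≤ length Y ∸ suc m) (sym s-length) (containsAll-length (suc m) all)
      nonzero : length Y ∸ suc m ≢ 0
      nonzero eq with () ← subst (suc K ≤_) eq bound

  -- Components of the residual graph

  _~_ : Vec Bool n → Vec Bool n → Set
  _~_ = Connected (ResidualEdge X)

  tl⁺ : List (Vec Bool n)
  tl⁺ = 01⋯1 m ∷ tl

  tl⁺-path : Path t (01⋯1 m) tl⁺ (01⋯1 m)
  tl⁺-path = step refl t-path

  path-connected : ∀ {u l v w} → Path t u l v → w ∈ l → u ~ w
  path-connected (step refl p) (here refl) = reflexive (ResidualEdge X)
  path-connected {u} (step refl p) (there i)   =
    transitive (ResidualEdge X) (return (t-ResidualEdge u)) (path-connected p i)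

  t-closed : ∀ {u} → u ∈ tl⁺ → t u ∈ tl⁺
  t-closed i with path-closed tl⁺-path i
  ... | inj₁ j  = j
  ... | inj₂ eq = here eq

  _≟_ : DecidableEquality (Vec Bool n)
  _≟_ = Vecₚ.≡-dec Boolₚ._≟_

  component : Vec Bool n → Fin 3
  component v with v ≟ zeros m
  ... | yes _ = zero
  ... | no _ with v ≟ ones m
  ...   | yes _ = suc zero
  ...   | no _  = suc (suc zero)

  component-zeros : component (zeros m) ≡ zero
  component-zeros with zeros m ≟ zeros m
  ... | yes _  = refl
  ... | no z≢z = contradiction refl z≢z

  component-ones : component (ones m) ≡ suc zero
  component-ones with ones m ≟ ones m
  ... | yes _  = refl
  ... | no z≢z = contradiction refl z≢z

  component-tl⁺ : ∀ {v} → v ∈ tl⁺ → component v ≡ suc (suc zero)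
  component-tl⁺ {v} i with v ≟ zeros m
  component-tl⁺ (there i) | yes refl = contradiction i zeros∉tl
  component-tl⁺ {v} i | no _ with v ≟ ones m
  component-tl⁺ (there i) | no _ | yes refl = contradiction i ones∉tl
  ... | no _ = refl

  -- Indexing by the component number leaves only the three diagonal cases when two vertices share a
  -- component.
  data Kind : Vec Bool n → Fin 3 → Set where
    isZeros : Kind (zeros m) zero
    isOnes  : Kind (ones m) (suc zero)
    onCycle : ∀ {v} → v ∈ tl⁺ → Kind v (suc (suc zero))

  kind : ∀ v → Kind v (component v)
  kind v with t-cover v
  ... | here refl         = subst (Kind v) (sym component-zeros) isZeros
  ... | there (here refl) = subst (Kind v) (sym component-ones) isOnes
  ... | there (there i)   = subst (Kind v) (sym (component-tl⁺ i)) (onCycle i)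

  kind-connected : ∀ {u v i} → Kind u i → Kind v i → u ~ v
  kind-connected isZeros     isZeros     = reflexive (ResidualEdge X)
  kind-connected isOnes      isOnes      = reflexive (ResidualEdge X)
  kind-connected (onCycle i) (onCycle j) = transitive (ResidualEdge X)
    (symmetric (ResidualEdge X) (path-connected tl⁺-path i)) (path-connected tl⁺-path j)

  component-t : ∀ u → component u ≡ component (t u)
  component-t u with t-cover u
  ... | here refl         = cong component (sym t-zeros)
  ... | there (here refl) = cong component (sym t-ones)
  ... | there (there i)   = ≡-trans (component-tl⁺ i) (sym (component-tl⁺ (t-closed i)))

  -- Residual edges are steps of `t`, and `t` preserves each loop and the cycle; the equality
  -- therefore extends to the generated equivalence.
  connected-component : ∀ {u v} → u ~ v → component u ≡ component v
  connected-component = gfold isEquivalence component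
    (λ {u} e → ≡-trans (component-t u) (cong component (sym (ResidualEdge-t e))))

  threeComponents : HasComponents (ResidualEdge X) 3
  threeComponents = record
    { component = component
    ; surjective = λ
      { zero             → zeros m , λ { refl → component-zeros }
      ; (suc zero)       → ones m , λ { refl → component-ones }
      ; (suc (suc zero)) → 01⋯1 m , λ { refl → component-tl⁺ (here refl) } }
    ; classifies = λ u v → mk⇔
        (λ eq → kind-connected (subst (Kind u) eq (kind u)) (kind v)) connected-component
    }

  kind-zero : ∀ {u} → Kind u zero → u ≡ zeros m
  kind-zero isZeros = refl

  kind-one : ∀ {u} → Kind u (suc zero) → u ≡ ones m
  kind-one isOnes = refl

  isDoubleHelix : IsDoubleHelix n X
  isDoubleHelix = record
    { isDeBruijn = isDeBruijn
    ; threeComponents = threeComponents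
    ; zeroLoop = subst (ResidualEdge X _) t-zeros (t-ResidualEdge _) , λ u c →
        kind-zero (subst (Kind u) (≡-trans (sym (connected-component c)) component-zeros) (kind u))
    ; oneLoop = subst (ResidualEdge X _) t-ones (t-ResidualEdge _) , λ u c →
        kind-one (subst (Kind u) (≡-trans (sym (connected-component c)) component-ones) (kind u))
    }

mainTheorem6 : (n : ℕ) → 2 ≤ n → Σ (List Bool) (λ X → IsDoubleHelix n X)
mainTheorem6 (suc (suc m)) (s≤s (s≤s z≤n)) = X , isDoubleHelix
  where open DoubleHelix (helix m)
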